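{- Any Single-Source DSO must take $\Omega(\min\{M^{1/2}n^{3/2},\, n^2\})$ bits of space on at least one undirected graph with $O(n)$ vertices and integer edge weights in the range $[1,M]$.
   Context: For an undirected edge-weighted graph $G$, a source $s$, a target $t$ and an edge $e$, $d(s,t,e)$ is the length of a shortest $s$-$t$ path in $G-e$ ($\infty$ if none). A Single-Source Distance Sensitivity Oracle (DSO) with source $s$ is a data structure (depending on $G$ and $s$) that answers every query $(t,e)$ by returning $d(s,t,e)$. -}

module Defs where

open import Data.Bool using (Bool)
open import Data.Fin using (Fin)
open import Data.Fin.Properties using (_≟_)
open import Data.List using (List; []; _∷_; length)
open import Data.List.Relation.Unary.Unique.Propositional using (Unique)
open import Data.Maybe using (Maybe; just; nothing)
open import Data.Nat using (ℕ; _+_; _*_; _^_; _⊓_; _≤_)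
open import Data.Product using (∃-syntax; _×_; _,_)
open import Data.Sum using (_⊎_; inj₁; inj₂)
open import Relation.Binary.PropositionalEquality using (_≡_; refl)
open import Relation.Nullary using (Dec; yes; no; ¬_; contradiction; _×-dec_; _⊎-dec_)
open import Relation.Nullary.Construct.Add.Supremum using (_⁺; [_]; ⊤⁺)

-- `nothing` marks a non-edge.
record Graph (N M : ℕ) : Set where
  field
    weight    : Fin N → Fin N → Maybe ℕ
    symmetric : ∀ u v → weight u v ≡ weight v u
    loopless  : ∀ v → weight v v ≡ nothing
    inRange   : ∀ {u v w} → weight u v ≡ just w → 1 ≤ w × w ≤ M

open Graph public

-- An undirected edge is presented by its endpoints, in either order.
Pair : ℕ → Set
Pair N = Fin N × Fin N

IsEdge : ∀ {N M} → Graph N M → Pair N → Set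
IsEdge G (u , v) = ∃[ w ] weight G u v ≡ just w

SameEdge : ∀ {N} → Pair N → Pair N → Set
SameEdge (u , v) (x , y) = (u ≡ x × v ≡ y) ⊎ (u ≡ y × v ≡ x)

sameEdge? : ∀ {N} (e f : Pair N) → Dec (SameEdge e f)
sameEdge? (u , v) (x , y) = (u ≟ x ×-dec v ≟ y) ⊎-dec (u ≟ y ×-dec v ≟ x)

SameEdge-swap : ∀ {N} (e : Pair N) {x y} → SameEdge e (x , y) → SameEdge e (y , x)
SameEdge-swap e (inj₁ p) = inj₂ p
SameEdge-swap e (inj₂ p) = inj₁ p

deletedWeight : ∀ {N M} → Graph N M → Pair N → Fin N → Fin N → Maybe ℕ
deletedWeight G e x y with sameEdge? e (x , y)
... | yes _ = nothing
... | no  _ = weight G x y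

infixl 6 _─_

_─_ : ∀ {N M} → Graph N M → Pair N → Graph N M
_─_ {N} {M} G e = record
  { weight    = deletedWeight G e
  ; symmetric = symmetric′
  ; loopless  = loopless′
  ; inRange   = inRange′
  }
  where
  symmetric′ : ∀ x y → deletedWeight G e x y ≡ deletedWeight G e y x
  symmetric′ x y with sameEdge? e (x , y) | sameEdge? e (y , x)
  ... | yes _ | yes _ = refl
  ... | yes p | no ¬q = contradiction (SameEdge-swap e p) ¬q
  ... | no ¬p | yes q = contradiction (SameEdge-swap e q) ¬p
  ... | no  _ | no  _ = symmetric G x y

  loopless′ : ∀ x → deletedWeight G e x x ≡ nothing
  loopless′ x with sameEdge? e (x , x)
  ... | yes _ = refl
  ... | no  _ = loopless G x

  inRange′ : ∀ {x y w} → deletedWeight G e x y ≡ just w → 1 ≤ w × w ≤ M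
  inRange′ {x} {y} eq with sameEdge? e (x , y)
  inRange′ () | yes _
  inRange′ eq | no  _ = inRange G eq

data Walk {N M} (G : Graph N M) : Fin N → Fin N → Set where
  stop : ∀ {u} → Walk G u u
  step : ∀ {u v t w} → weight G u v ≡ just w → Walk G v t → Walk G u t

module _ {N M} {G : Graph N M} where

  vertices : ∀ {u t} → Walk G u t → List (Fin N)
  vertices {u} stop       = u ∷ []
  vertices {u} (step _ p) = u ∷ vertices p

  totalWeight : ∀ {u t} → Walk G u t → ℕ
  totalWeight stop               = 0
  totalWeight (step {w = w} _ p) = w + totalWeight p

record Path {N M} (G : Graph N M) (s t : Fin N) : Set where
  constructor path
  field
    walk   : Walk G s t
    simple : Unique (vertices walk)

  pathLength : ℕ
  pathLength = totalWeight walk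

open Path public

-- Here ⊤⁺ plays the role of ∞.
IsDistance : ∀ {N M} → Graph N M → Fin N → Fin N → ℕ ⁺ → Set
IsDistance G s t [ d ] =
  (∃[ p ] pathLength {G = G} {s} {t} p ≡ d) × (∀ (p : Path G s t) → d ≤ pathLength p)
IsDistance G s t ⊤⁺    = ¬ Path G s t

-- The query algorithm is given N, M and s for free: only the bits stored
-- by `preprocess` count as space, and they are all it may learn about G.
record SingleSourceDSO (M : ℕ) : Set where
  field
    preprocess : ∀ {N} → Graph N M → Fin N → List Bool
    query      : ∀ {N} → Fin N → List Bool → Fin N → Pair N → ℕ ⁺
    correct    : ∀ {N} (G : Graph N M) (s t : Fin N) (e : Pair N) → IsEdge G e →
                 IsDistance (G ─ e) s t (query s (preprocess G s) t e)

  space : ∀ {N} → Graph N M → Fin N → ℕ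
  space G s = length (preprocess G s)

-- min{M^(1/2) n^(3/2), n²} ≤ x, with both sides squared to stay inside ℕ.
min[√M·n^3/2,n²]≤ : (M n x : ℕ) → Set
min[√M·n^3/2,n²]≤ M n x = (M * n ^ 3) ⊓ (n ^ 4) ≤ x ^ 2

{-
The hard graph is a comb: a spine v_0, …, v_L of unit edges with s = v_L, and for every k < L a detour
of total weight 2k + 1 from v_{k+1} to a vertex x_k, which is joined to the target t_j by a unit edge
exactly when the bit b k j is set.  If the spine edge v_{i+1} v_i fails, only the detours k ≥ i remain
usable, and s reaches x_k through its own detour in L + k steps; so d(s, t_j, v_{i+1} v_i) = L + i + 1
when b i j is set and is larger otherwise (certified by a 1-Lipschitz potential).  The oracle therefore
determines all L · n bits, and some comb needs at least that many bits of storage.  A detour fits on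
O(1 + L/M) vertices, so L = ⌊√(min(M n, n²))⌋ keeps the order linear in n.
-}
module Submission where

open import Defs
open import Data.Bool using (Bool; true; false)
import Data.Bool.Properties as Bool
open import Data.Nat using (ℕ; zero; suc; _+_; _*_; _∸_; _^_; _⊓_; _≤_; _<_; _/_; _%_; _≤?_; _<?_; NonZero; >-nonZero⁻¹; z≤n; s≤s; s≤s⁻¹; >-nonZero)
open import Data.Nat.Binary using (ℕᵇ; 1+[2_]; 2[1+_])
import Data.Nat.Binary as ℕᵇ
import Data.Nat.Binary.Properties as ℕᵇ
open import Data.Nat.DivMod using (m%n<n; m≡m%n+[m/n]*n; m/n*n≤m; /-monoˡ-≤)
open import Data.Nat.Properties hiding (_≟_; _≤?_; _<?_)
open import Data.Nat.Tactic.RingSolver using (solve-∀)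
open import Data.Fin using (Fin; zero; suc; toℕ; fromℕ; fromℕ<; inject₁; combine; finToFun; funToFin)
open import Data.Fin.Induction using (<-weakInduction)
open import Data.Fin.Properties using (_≟_; any?; pigeonhole; toℕ-injective; toℕ-inject₁; toℕ-fromℕ; toℕ-fromℕ<; toℕ<n; combine-surjective; funToFin-finToFin; fromℕ<-injective; +↔⊎; *↔×; 2↔Bool)
open import Data.List using (List; []; _∷_; length)
open import Data.List.Membership.Propositional using (_∈_)
open import Data.List.Relation.Unary.All.Properties using (¬Any⇒All¬)
open import Data.List.Relation.Unary.AllPairs using ([]; _∷_)
import Data.List.Relation.Unary.All as All
open import Data.List.Relation.Unary.Any using (here; there)
import Data.List.Relation.Unary.Any as Any
open import Data.List.Relation.Unary.Unique.Propositional using (Unique)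
open import Data.Maybe using (Maybe; just; nothing)
open import Data.Product using (Σ-syntax; ∃-syntax; _×_; _,_; proj₁; proj₂; swap)
open import Data.Sum using (_⊎_; inj₁; inj₂)
open import Data.Sum.Properties using (inj₁-injective)
import Data.Sum as Sum
open import Data.Sum.Function.Propositional using (_⊎-↔_)
open import Function using (_∘_; _↔_; Inverse; Injection; Injective)
open import Function.Construct.Composition using (_↔-∘_)
open import Function.Construct.Identity using (↔-id)
open import Function.Properties.Inverse using (↔⇒↣; ↔-sym)
open import Relation.Binary.PropositionalEquality using (_≡_; _≢_; _≗_; refl; sym; trans; cong; cong₂; subst; module ≡-Reasoning)
open import Relation.Nullary using (Dec; yes; no; ¬_; contradiction; _×-dec_; _⊎-dec_)
open import Relation.Nullary.Construct.Add.Supremum using ([_]; ⊤⁺)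
open SingleSourceDSO using (space; preprocess; query; correct)

-- Bit strings: coding and counting.

funToFin-cong : ∀ {m n} {f g : Fin m → Fin n} → f ≗ g → funToFin f ≡ funToFin g
funToFin-cong {zero}  f≗g = refl
funToFin-cong {suc m} f≗g = cong₂ combine (f≗g zero) (funToFin-cong (f≗g ∘ suc))

bit : ∀ {B} → Fin (2 ^ B) → Fin B → Bool
bit c = Inverse.to 2↔Bool ∘ finToFun c

bit-injective : ∀ {B} {c c′ : Fin (2 ^ B)} → bit {B} c ≗ bit c′ → c ≡ c′
bit-injective {B} {c} {c′} eq = begin
  c                                ≡⟨ funToFin-finToFin {B} {2} c ⟨
  funToFin (finToFun {2} {B} c)    ≡⟨ funToFin-cong (Injection.injective (↔⇒↣ 2↔Bool) ∘ eq) ⟩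
  funToFin (finToFun {2} {B} c′)   ≡⟨ funToFin-finToFin {B} {2} c′ ⟩
  c′                               ∎
  where open ≡-Reasoning

-- Bijective base 2 also distinguishes strings of different lengths.
bijectiveBinary : List Bool → ℕᵇ
bijectiveBinary []          = ℕᵇ.zero
bijectiveBinary (false ∷ x) = 1+[2 bijectiveBinary x ]
bijectiveBinary (true ∷ x)  = 2[1+ bijectiveBinary x ]

bijectiveBinary-injective : Injective _≡_ _≡_ bijectiveBinary
bijectiveBinary-injective {[]}        {[]}        eq = refl
bijectiveBinary-injective {[]}        {false ∷ y} ()
bijectiveBinary-injective {[]}        {true ∷ y}  ()
bijectiveBinary-injective {false ∷ x} {[]}        ()
bijectiveBinary-injective {true ∷ x}  {[]}        ()
bijectiveBinary-injective {false ∷ x} {false ∷ y} eq =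
  cong (false ∷_) (bijectiveBinary-injective (ℕᵇ.1+[2_]-injective eq))
bijectiveBinary-injective {true ∷ x}  {true ∷ y}  eq =
  cong (true ∷_) (bijectiveBinary-injective (ℕᵇ.2[1+_]-injective eq))
bijectiveBinary-injective {false ∷ x} {true ∷ y}  ()
bijectiveBinary-injective {true ∷ x}  {false ∷ y} ()

-- The extreme string of each length consists of `true` only, and for it equality holds. Hence every
-- string shorter than `B` has a code below `2 ^ B ∸ 1`.
bijectiveBinary-bound : ∀ x → 2 + ℕᵇ.toℕ (bijectiveBinary x) ≤ 2 ^ suc (length x)
bijectiveBinary-bound []          = ≤-refl
bijectiveBinary-bound (false ∷ x) = begin
  2 + suc (2 * ℕᵇ.toℕ (bijectiveBinary x))   ≤⟨ n≤1+n _ ⟩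
  4 + 2 * ℕᵇ.toℕ (bijectiveBinary x)         ≡⟨ *-distribˡ-+ 2 2 (ℕᵇ.toℕ (bijectiveBinary x)) ⟨
  2 * (2 + ℕᵇ.toℕ (bijectiveBinary x))       ≤⟨ *-monoʳ-≤ 2 (bijectiveBinary-bound x) ⟩
  2 ^ suc (suc (length x))                   ∎
  where open ≤-Reasoning
bijectiveBinary-bound (true ∷ x)  = begin
  2 + 2 * suc (ℕᵇ.toℕ (bijectiveBinary x))   ≡⟨ *-distribˡ-+ 2 1 (suc (ℕᵇ.toℕ (bijectiveBinary x))) ⟨
  2 * (2 + ℕᵇ.toℕ (bijectiveBinary x))       ≤⟨ *-monoʳ-≤ 2 (bijectiveBinary-bound x) ⟩
  2 ^ suc (suc (length x))                   ∎
  where open ≤-Reasoning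

-- Only `2 ^ B ∸ 1` strings are shorter than `B`, one fewer than there are arguments of `f`, so the
-- pigeonhole principle would give a collision.
injection-has-long-string : ∀ B (f : Fin (2 ^ B) → List Bool) → Injective _≡_ _≡_ f →
                            ∃[ c ] B ≤ length (f c)
injection-has-long-string B f f-injective with any? (λ c → B ≤? length (f c))
... | yes found = found
... | no  none  = contradiction (f-injective fc≡fc′) (<⇒≢ c<c′ ∘ cong toℕ)
  where
  short : ∀ c → suc (ℕᵇ.toℕ (bijectiveBinary (f c))) < 2 ^ B
  short c = ≤-trans (bijectiveBinary-bound (f c))
                    (^-monoʳ-≤ 2 (≰⇒> (λ long → none (c , long))))

  short′ : ∀ c → ℕᵇ.toℕ (bijectiveBinary (f c)) < 2 ^ B ∸ 1
  short′ c = ∸-monoˡ-≤ 1 (short c)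

  collision = pigeonhole (∸-monoʳ-< {2 ^ B} ≤-refl (m^n>0 2 B)) (λ c → fromℕ< (short′ c))
  c    = proj₁ collision
  c′   = proj₁ (proj₂ collision)
  c<c′ = proj₁ (proj₂ (proj₂ collision))

  fc≡fc′ : f c ≡ f c′
  fc≡fc′ = bijectiveBinary-injective (ℕᵇ.toℕ-injective
    (fromℕ<-injective _ _ (short′ c) (short′ c′) (proj₂ (proj₂ (proj₂ collision)))))

-- Loop erasure, potentials and edge deletion.

module _ {N M} {G : Graph N M} where

  suffixPath : ∀ {u v t} (p : Walk G v t) → Unique (vertices p) → u ∈ vertices p →
               Σ[ q ∈ Path G u t ] pathLength q ≤ totalWeight p
  suffixPath p@stop       simple       (here refl) = path p simple , ≤-refl
  suffixPath p@(step _ _) simple       (here refl) = path p simple , ≤-refl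
  suffixPath (step {w = w} _ p) (_ ∷ simple) (there u∈p) =
    let q , q≤p = suffixPath p simple u∈p in q , ≤-trans q≤p (m≤n+m _ w)

  -- Loop erasure: if the new first vertex already lies on the path, the loop up to that occurrence
  -- is dropped, which never adds weight. Upper bounds on distances may thus be given by walks, with
  -- no check of simplicity.
  walk⇒path : ∀ {u t} (p : Walk G u t) → Σ[ q ∈ Path G u t ] pathLength q ≤ totalWeight p
  walk⇒path stop = path stop (All.[] ∷ []) , ≤-refl
  walk⇒path {u} (step {w = w} e p) with walk⇒path p
  ... | path p′ simple , p′≤p with Any.any? (u ≟_) (vertices p′)
  ...   | no  u∉p′ = path (step e p′) (¬Any⇒All¬ _ u∉p′ ∷ simple) , +-monoʳ-≤ w p′≤p
  ...   | yes u∈p′ =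
    let q , q≤p′ = suffixPath p′ simple u∈p′
    in q , ≤-trans q≤p′ (≤-trans p′≤p (m≤n+m _ w))

  -- The Lipschitz inequalities telescope along the walk. This is the tool for bounding distances
  -- from below.
  potential-bound : (φ : Fin N → ℕ) → (∀ u v {w} → weight G u v ≡ just w → φ u ≤ w + φ v) →
                    ∀ {u t} (p : Walk G u t) → φ u ≤ totalWeight p + φ t
  potential-bound φ lip stop = ≤-refl
  potential-bound φ lip {u} {t} (step {v = v} {w = w} e p) = begin
    φ u                         ≤⟨ lip u v e ⟩
    w + φ v                     ≤⟨ +-monoʳ-≤ w (potential-bound φ lip p) ⟩
    w + (totalWeight p + φ t)   ≡⟨ +-assoc w _ _ ⟨
    w + totalWeight p + φ t     ∎
    where open ≤-Reasoning

  deletion-keeps : ∀ {e u v w} → ¬ SameEdge e (u , v) → weight G u v ≡ just w →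
                   weight (G ─ e) u v ≡ just w
  deletion-keeps {e} {u} {v} ¬same eq with sameEdge? e (u , v)
  ... | yes same = contradiction same ¬same
  ... | no  _    = eq

  deletion-reflects : ∀ {e u v w} → weight (G ─ e) u v ≡ just w →
                      ¬ SameEdge e (u , v) × weight G u v ≡ just w
  deletion-reflects {e} {u} {v} eq with sameEdge? e (u , v)
  deletion-reflects () | yes _
  deletion-reflects eq | no ¬same = ¬same , eq

WalkOfWeight : ∀ {N M} (G : Graph N M) (u t : Fin N) → ℕ → Set
WalkOfWeight G u t d = Σ[ p ∈ Walk G u t ] totalWeight p ≡ d

-- A finite answer valid for both graphs would be at most `d` because of `G`, yet be the length of a
-- path in `H`, hence exceed `d`. The answer `⊤⁺` is refuted by the walk in `G` alone.
distances-differ : ∀ {N M} {G H : Graph N M} {s t d} x →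
                   WalkOfWeight G s t d → (∀ (p : Walk H s t) → d < totalWeight p) →
                   IsDistance G s t x → ¬ IsDistance H s t x
distances-differ ⊤⁺    (p , _)    far noPath _ = noPath (proj₁ (walk⇒path p))
distances-differ [ x ] (p , refl) far (_ , x-least) ((q , refl) , _) =
  let p′ , p′≤p = walk⇒path p
  in <⇒≱ (far (walk q)) (≤-trans (x-least p′) p′≤p)

-- Conditional edges, adjacency and two-sided Lipschitz bounds.

edgeIf : ∀ {P : Set} → Dec P → ℕ → Maybe ℕ
edgeIf (yes _) w = just w
edgeIf (no _)  w = nothing

edgeIf-elim : ∀ {P : Set} {w w′} (d : Dec P) → edgeIf d w ≡ just w′ → P × w ≡ w′
edgeIf-elim (yes p) refl = p , refl

edgeIf-yes : ∀ {P : Set} {w} (d : Dec P) → P → edgeIf d w ≡ just w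
edgeIf-yes (yes _) p = refl
edgeIf-yes (no ¬p) p = contradiction p ¬p

edgeIf-no : ∀ {P : Set} {w} (d : Dec P) → ¬ P → edgeIf d w ≡ nothing
edgeIf-no (yes p) ¬p = contradiction p ¬p
edgeIf-no (no _)  ¬p = refl

edgeIf-cong : ∀ {P Q : Set} {w} (d : Dec P) (e : Dec Q) → (P → Q) → (Q → P) →
              edgeIf d w ≡ edgeIf e w
edgeIf-cong (yes _) (yes _) _ _ = refl
edgeIf-cong (yes p) (no ¬q) f _ = contradiction (f p) ¬q
edgeIf-cong (no ¬p) (yes q) _ g = contradiction (g q) ¬p
edgeIf-cong (no _)  (no _)  _ _ = refl

Adjacent : ∀ {m} → Fin m → Fin m → Set
Adjacent x y = suc (toℕ x) ≡ toℕ y ⊎ suc (toℕ y) ≡ toℕ x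

adjacent? : ∀ {m} (x y : Fin m) → Dec (Adjacent x y)
adjacent? x y = suc (toℕ x) Data.Nat.≟ toℕ y ⊎-dec suc (toℕ y) Data.Nat.≟ toℕ x

Adjacent-irrefl : ∀ {m} {x : Fin m} → ¬ Adjacent x x
Adjacent-irrefl = Sum.[ 1+n≢n , 1+n≢n ]

suc-inject₁-adjacent : ∀ {m} (x : Fin m) → Adjacent (suc x) (inject₁ x)
suc-inject₁-adjacent x = inj₂ (cong suc (toℕ-inject₁ x))

-- Two-sided, so that one check serves both orientations of an edge, by `swap`.
Within : ℕ → ℕ → ℕ → Set
Within w a b = a ≤ w + b × b ≤ w + a

raisedIf : ∀ {P : Set} → Dec P → ℕ → ℕ
raisedIf (yes _) h = suc h
raisedIf (no _)  h = 1

-- The conditions will say that a vertex is on the side of the failed edge that s still reaches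
-- along the spine. As they agree, a raised value never faces the default 1.
raisedIf-within : ∀ {P Q : Set} {w h h′} (d : Dec P) (e : Dec Q) → (P → Q) → (Q → P) →
                 (P → Within w h h′) → Within w (raisedIf d h) (raisedIf e h′)
raisedIf-within {w = w} {h} {h′} (yes p) (yes _) _ _ near =
  let h≤h′ , h′≤h = near p
  in ≤-trans (s≤s h≤h′) (≤-reflexive (sym (+-suc w h′))) ,
     ≤-trans (s≤s h′≤h) (≤-reflexive (sym (+-suc w h)))
raisedIf-within (yes p) (no ¬q) f _ _ = contradiction (f p) ¬q
raisedIf-within (no ¬p) (yes q) _ g _ = contradiction (g q) ¬p
raisedIf-within {w = w} (no _) (no _) _ _ _ = m≤n+m 1 w , m≤n+m 1 w

raisedIf-positive : ∀ {P : Set} (d : Dec P) h → 1 ≤ raisedIf d h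
raisedIf-positive (yes _) h = s≤s z≤n
raisedIf-positive (no _)  h = ≤-refl

-- Leaving `d′` free lets each step carry its own arithmetic, so walks compose without transport.
stepWalk : ∀ {N M} {G : Graph N M} {u v t w d d′} → weight G u v ≡ just w →
           w + d ≡ d′ → WalkOfWeight G v t d → WalkOfWeight G u t d′
stepWalk {w = w} e refl (p , eq) = step e p , cong (w +_) eq

-- The comb graph.

module Comb (M L n : ℕ) .{{_ : NonZero M}} where

  -- One position for each height from 0 to `2 * L / M`, which bounds every `hookHeight`.
  chainLength : ℕ
  chainLength = suc (2 * L / M)

  -- Structured vertices allow definitions by cases; `labelling` transfers them to `Fin order`, as
  -- `Graph` requires. The vertex x_k is `detour k zero`.
  Vertex : Set
  Vertex = Fin (suc L) ⊎ (Fin L × Fin chainLength) ⊎ Fin n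

  pattern spine x    = inj₁ x
  pattern detour k q = inj₂ (inj₁ (k , q))
  pattern target j   = inj₂ (inj₂ j)

  order : ℕ
  order = suc L + (L * chainLength + n)

  labelling : Fin order ↔ Vertex
  labelling = (↔-id _ ⊎-↔ ((*↔× ⊎-↔ ↔-id _) ↔-∘ +↔⊎)) ↔-∘ +↔⊎

  name : Fin order → Vertex
  name = Inverse.to labelling

  at : Vertex → Fin order
  at = Inverse.from labelling

  name-at : ∀ v → name (at v) ≡ v
  name-at = Inverse.strictlyInverseˡ labelling

  at-name : ∀ u → at (name u) ≡ u
  at-name = Inverse.strictlyInverseʳ labelling

  -- All chains have the same number of vertices and edges of weight M; a detour gets its own weight
  -- 2k + 1 from where v_{k+1} is hooked onto the chain.  The part beyond the hook is a dead end.
  hookHeight hookWeight : Fin L → ℕ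
  hookHeight k = 2 * toℕ k / M
  hookWeight k = suc (2 * toℕ k % M)

  hook : Fin L → Fin chainLength
  hook k = fromℕ< (s≤s (/-monoˡ-≤ M (*-monoʳ-≤ 2 (<⇒≤ (toℕ<n k)))))

  hook-height : ∀ k → toℕ (hook k) ≡ hookHeight k
  hook-height k = toℕ-fromℕ< _

  -- Division of 2k by `M`: the quotient counts the full edges of weight `M`, and the remainder plus
  -- one is the weight of the hook edge, which therefore lies between 1 and `M`.
  hook-total : ∀ k → hookWeight k + M * hookHeight k ≡ suc (2 * toℕ k)
  hook-total k = cong suc (trans (cong (2 * toℕ k % M +_) (*-comm M _))
                                 (sym (m≡m%n+[m/n]*n (2 * toℕ k) M)))

  Hooked : Fin (suc L) → Fin L → Fin chainLength → Set
  Hooked x k q = x ≡ suc k × q ≡ hook k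

  hooked? : ∀ x k q → Dec (Hooked x k q)
  hooked? x k q = x ≟ suc k ×-dec q ≟ hook k

  Linked : (k k′ : Fin L) (q q′ : Fin chainLength) → Set
  Linked k k′ q q′ = k ≡ k′ × Adjacent q q′

  linked? : ∀ k k′ q q′ → Dec (Linked k k′ q q′)
  linked? k k′ q q′ = k ≟ k′ ×-dec adjacent? q q′

  module Rows (b : Fin L → Fin n → Bool) where

    Lit : Fin L → Fin chainLength → Fin n → Set
    Lit k q j = q ≡ zero × b k j ≡ true

    lit? : ∀ k q j → Dec (Lit k q j)
    lit? k q j = q ≟ zero ×-dec b k j Bool.≟ true

    combWeight : Vertex → Vertex → Maybe ℕ
    combWeight (spine x)    (spine y)      = edgeIf (adjacent? x y) 1
    combWeight (spine x)    (detour k q)   = edgeIf (hooked? x k q) (hookWeight k)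
    combWeight (detour k q) (spine x)      = edgeIf (hooked? x k q) (hookWeight k)
    combWeight (detour k q) (detour k′ q′) = edgeIf (linked? k k′ q q′) M
    combWeight (detour k q) (target j)     = edgeIf (lit? k q j) 1
    combWeight (target j)   (detour k q)   = edgeIf (lit? k q j) 1
    combWeight (spine _)    (target _)     = nothing
    combWeight (target _)   (spine _)      = nothing
    combWeight (target _)   (target _)     = nothing

    combWeight-sym : ∀ u v → combWeight u v ≡ combWeight v u
    combWeight-sym (spine x)    (spine y)      =
      edgeIf-cong (adjacent? x y) (adjacent? y x) Sum.swap Sum.swap
    combWeight-sym (spine _)    (detour _ _)   = refl
    combWeight-sym (detour _ _) (spine _)      = refl
    combWeight-sym (detour k q) (detour k′ q′) =
      edgeIf-cong (linked? k k′ q q′) (linked? k′ k q′ q)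
        (λ { (eq , a) → sym eq , Sum.swap a }) (λ { (eq , a) → sym eq , Sum.swap a })
    combWeight-sym (detour _ _) (target _)     = refl
    combWeight-sym (target _)   (detour _ _)   = refl
    combWeight-sym (spine _)    (target _)     = refl
    combWeight-sym (target _)   (spine _)      = refl
    combWeight-sym (target _)   (target _)     = refl

    combWeight-loopless : ∀ v → combWeight v v ≡ nothing
    combWeight-loopless (spine x)    = edgeIf-no (adjacent? x x) Adjacent-irrefl
    combWeight-loopless (detour k q) = edgeIf-no (linked? k k q q) (Adjacent-irrefl ∘ proj₂)
    combWeight-loopless (target _)   = refl

    unit-inRange : 1 ≤ 1 × 1 ≤ M
    unit-inRange = ≤-refl , >-nonZero⁻¹ M

    hook-inRange : ∀ k → 1 ≤ hookWeight k × hookWeight k ≤ M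
    hook-inRange k = s≤s z≤n , m%n<n (2 * toℕ k) M

    combWeight-inRange : ∀ u v {w} → combWeight u v ≡ just w → 1 ≤ w × w ≤ M
    combWeight-inRange (spine x)    (spine y)      eq with edgeIf-elim (adjacent? x y) eq
    ... | _ , refl = unit-inRange
    combWeight-inRange (spine x)    (detour k q)   eq with edgeIf-elim (hooked? x k q) eq
    ... | _ , refl = hook-inRange k
    combWeight-inRange (detour k q) (spine x)      eq with edgeIf-elim (hooked? x k q) eq
    ... | _ , refl = hook-inRange k
    combWeight-inRange (detour k q) (detour k′ q′) eq with edgeIf-elim (linked? k k′ q q′) eq
    ... | _ , refl = >-nonZero⁻¹ M , ≤-refl
    combWeight-inRange (detour k q) (target j)     eq with edgeIf-elim (lit? k q j) eq
    ... | _ , refl = unit-inRange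
    combWeight-inRange (target j)   (detour k q)   eq with edgeIf-elim (lit? k q j) eq
    ... | _ , refl = unit-inRange

    comb : Graph order M
    comb = record
      { weight    = λ u v → combWeight (name u) (name v)
      ; symmetric = λ u v → combWeight-sym (name u) (name v)
      ; loopless  = λ v → combWeight-loopless (name v)
      ; inRange   = λ {u} {v} → combWeight-inRange (name u) (name v)
      }

    edge-at : ∀ u v {w} → combWeight u v ≡ just w → weight comb (at u) (at v) ≡ just w
    edge-at u v eq = trans (cong₂ combWeight (name-at u) (name-at v)) eq

  -- The failed spine edge.

  source : Fin order
  source = at (spine (fromℕ L))

  cut : Fin L → Pair order
  cut i = at (spine (suc i)) , at (spine (inject₁ i))

  -- `SameEdge (cut i)` pulled back along `at`, so that clashing constructors show that edges off
  -- the spine survive.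
  Cut : Fin L → Vertex → Vertex → Set
  Cut i u v = (spine (suc i) ≡ u × spine (inject₁ i) ≡ v)
            ⊎ (spine (suc i) ≡ v × spine (inject₁ i) ≡ u)

  at-injective : Injective _≡_ _≡_ at
  at-injective = Injection.injective (↔⇒↣ (↔-sym labelling))

  module _ (b : Fin L → Fin n → Bool) (i : Fin L) where
    open Rows b

    damaged : Graph order M
    damaged = comb ─ cut i

    cut-isEdge : IsEdge comb (cut i)
    cut-isEdge = 1 , edge-at (spine (suc i)) (spine (inject₁ i))
      (edgeIf-yes (adjacent? (suc i) (inject₁ i)) (suc-inject₁-adjacent i))

    surviving-edge : ∀ u v {w} → ¬ Cut i u v → combWeight u v ≡ just w →
                     weight damaged (at u) (at v) ≡ just w
    surviving-edge u v uncut eq = deletion-keeps {G = comb} {e = cut i} {at u} {at v}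
      (uncut ∘ Sum.map (λ (p , q) → at-injective p , at-injective q)
                       (λ (p , q) → at-injective p , at-injective q))
      (edge-at u v eq)

    -- A set bit: a short walk around the failed edge.

    module _ (j : Fin n) (lit : b i j ≡ true) where

      detour-walk : ∀ q → WalkOfWeight damaged (at (detour i q)) (at (target j)) (suc (M * toℕ q))
      detour-walk = <-weakInduction _
        (stepWalk
          (surviving-edge (detour i zero) (target j) (λ { (inj₁ ()) ; (inj₂ ()) })
            (edgeIf-yes (lit? i zero j) (refl , lit)))
         
                  (cong suc (sym (*-zeroʳ M))) (stop , refl))
        (λ q → stepWalk
          (surviving-edge (detour i (suc q)) (detour i (inject₁ q)) (λ { (inj₁ ()) ; (inj₂ ()) })
            (edgeIf-yes (linked? i i (suc q) (inject₁ q)) (refl , suc-inject₁-adjacent q)))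
          (begin
            M + suc (M * toℕ (inject₁ q))   ≡⟨ +-suc M _ ⟩
            suc (M + M * toℕ (inject₁ q))   ≡⟨ cong (λ m → suc (M + M * m)) (toℕ-inject₁ q) ⟩
            suc (M + M * toℕ q)             ≡⟨ cong suc (*-suc M (toℕ q)) ⟨
            suc (M * suc (toℕ q))           ∎))
        where open ≡-Reasoning

      -- The detour contributes 2i + 1 and the edge into t_j one more. The sum is split so as to
      -- match `spine-walk` at x = i + 1.
      hook-walk : WalkOfWeight damaged (at (spine (suc i))) (at (target j)) (suc (toℕ i) + suc (toℕ i))
      hook-walk = stepWalk
        (surviving-edge (spine (suc i)) (detour i (hook i)) (λ { (inj₁ (_ , ())) ; (inj₂ (() , _)) })
          (edgeIf-yes (hooked? (suc i) i (hook i)) (refl , refl)))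
        (begin
          hookWeight i + suc (M * toℕ (hook i))     ≡⟨ +-suc (hookWeight i) _ ⟩
          suc (hookWeight i + M * toℕ (hook i))     ≡⟨ cong (λ h → suc (hookWeight i + M * h)) (hook-height i) ⟩
          suc (hookWeight i + M * hookHeight i)     ≡⟨ cong suc (hook-total i) ⟩
          suc (suc (2 * toℕ i))                     ≡⟨ double (toℕ i) ⟩
          suc (toℕ i) + suc (toℕ i)                 ∎)
        (detour-walk (hook i))
        where
        open ≡-Reasoning
        double : ∀ m → suc (suc (2 * m)) ≡ suc m + suc m
        double = solve-∀

      spine-walk : ∀ x → toℕ i < toℕ x →
                   WalkOfWeight damaged (at (spine x)) (at (target j)) (toℕ x + suc (toℕ i))
      spine-walk = <-weakInduction _ (λ ()) descend
        where
        descend : ∀ x →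
          (toℕ i < toℕ (inject₁ x) →
             WalkOfWeight damaged (at (spine (inject₁ x))) (at (target j)) (toℕ (inject₁ x) + suc (toℕ i))) →
          toℕ i < suc (toℕ x) →
          WalkOfWeight damaged (at (spine (suc x))) (at (target j)) (suc (toℕ x) + suc (toℕ i))
        -- The spine edge below v_{x+1} is the failed one exactly when x = i; there the detour takes
        -- over, and this is the true base of the induction, the case of v_0 being vacuous.
        descend x ih i≤x with i ≟ x
        ... | yes refl = hook-walk
        ... | no  i≢x  = stepWalk
          (surviving-edge (spine (suc x)) (spine (inject₁ x)) uncut
            (edgeIf-yes (adjacent? (suc x) (inject₁ x)) (suc-inject₁-adjacent x)))
          (cong (λ m → suc (m + suc (toℕ i))) (toℕ-inject₁ x))
          (ih (subst (toℕ i <_) (sym (toℕ-inject₁ x)) i<x))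
          where
          i<x : toℕ i < toℕ x
          i<x = ≤∧≢⇒< (s≤s⁻¹ i≤x) (i≢x ∘ toℕ-injective)

          uncut : ¬ Cut i (spine (suc x)) (spine (inject₁ x))
          uncut (inj₁ (refl , _)) = i≢x refl
          -- The reversed orientation would force i = x + 1, against i < x.
          uncut (inj₂ (_ , eq))   =
            <⇒≢ (m<n⇒m<1+n i<x) (trans (sym (toℕ-inject₁ i)) (cong toℕ (inj₁-injective eq)))

      lit-walk : WalkOfWeight damaged source (at (target j)) (L + suc (toℕ i))
      lit-walk = subst (λ m → WalkOfWeight damaged source (at (target j)) (m + suc (toℕ i)))
        (toℕ-fromℕ L)
        (spine-walk (fromℕ L) (subst (toℕ i <_) (sym (toℕ-fromℕ L)) (toℕ<n i)))

    -- An unset bit: the potential that bounds all walks from below.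

    module _ (j : Fin n) where

      -- `level` is (L + i + 2) minus the distance from s (except that it is constant on the dead
      -- ends of the chains), raised to at least 1 everywhere but at t_j.
      -- When b i j is unset, x_i is the only x_k at level 2, and it is not adjacent to t_j.
      spineLevel : ℕ → ℕ
      spineLevel x = raisedIf (suc (toℕ i) ≤? x) (suc (toℕ i + x))

      detourLevel : Fin L → ℕ → ℕ
      detourLevel k q = raisedIf (toℕ i ≤? toℕ k) ((suc (toℕ i) + M * (q ⊓ hookHeight k)) ∸ toℕ k)

      targetLevel : Fin n → ℕ
      targetLevel j′ with j′ ≟ j
      ... | yes _ = 0
      ... | no  _ = 1

      targetLevel-self : targetLevel j ≡ 0
      targetLevel-self with j ≟ j
      ... | yes _  = refl
      ... | no j≢j = contradiction refl j≢j

      targetLevel-other : ∀ {j′} → j′ ≢ j → targetLevel j′ ≡ 1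
      targetLevel-other {j′} j′≢j with j′ ≟ j
      ... | yes eq = contradiction eq j′≢j
      ... | no  _  = refl

      targetLevel≤1 : ∀ j′ → targetLevel j′ ≤ 1
      targetLevel≤1 j′ with j′ ≟ j
      ... | yes _ = z≤n
      ... | no  _ = ≤-refl

      level : Vertex → ℕ
      level (spine x)    = spineLevel (toℕ x)
      level (detour k q) = detourLevel k (toℕ q)
      level (target j′)  = targetLevel j′

      -- The only spine edge whose ends lie on different sides of the cut is the failed one, which
      -- `toℕ i ≢ x` excludes.
      spine-within : ∀ {x y} → suc x ≡ y → toℕ i ≢ x → Within 1 (spineLevel x) (spineLevel y)
      spine-within {x} refl i≢x = raisedIf-within (suc (toℕ i) ≤? x) (suc (toℕ i) ≤? suc x)
        m<n⇒m<1+n (λ i≤x → ≤∧≢⇒< (s≤s⁻¹ i≤x) i≢x)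
        (λ _ → s≤s (≤-trans (+-monoʳ-≤ (toℕ i) (n≤1+n x)) (n≤1+n _)) ,
               s≤s (≤-reflexive (+-suc (toℕ i) x)))

      -- By `hook-total` the untruncated height at the hook is that of v_{k+1} minus `hookWeight k`;
      -- truncation at zero can only make the drop smaller.
      hook-within : ∀ k → Within (hookWeight k) (spineLevel (suc (toℕ k))) (detourLevel k (toℕ (hook k)))
      hook-within k = raisedIf-within (suc (toℕ i) ≤? suc m) (toℕ i ≤? m) s≤s⁻¹ s≤s (λ _ → upper , lower)
        where
        open ≤-Reasoning
        m = toℕ k
        r = hookWeight k
        a = M * (toℕ (hook k) ⊓ hookHeight k)

        r+a : r + a ≡ suc (2 * m)
        r+a = trans (cong (λ h → r + M * h) (trans (cong (_⊓ hookHeight k) (hook-height k)) (⊓-idem (hookHeight k))))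
                    (hook-total k)

        rearrange₁ : ∀ i m → suc (i + suc m) + m ≡ suc i + suc (2 * m)
        rearrange₁ = solve-∀
        rearrange₂ : ∀ i r a → suc i + (r + a) ≡ r + (suc i + a)
        rearrange₂ = solve-∀
        rearrange₃ : ∀ i m r → suc i + suc (2 * m) + r ≡ m + (r + suc (i + suc m))
        rearrange₃ = solve-∀

        upper : suc (toℕ i + suc m) ≤ r + ((suc (toℕ i) + a) ∸ m)
        -- Adding `m` removes the subtraction; the inequality used for this holds also when the
        -- subtraction truncates.
        upper = +-cancelʳ-≤ m _ _ (begin
          suc (toℕ i + suc m) + m                 ≡⟨ rearrange₁ (toℕ i) m ⟩
          suc (toℕ i) + suc (2 * m)               ≡⟨ cong (suc (toℕ i) +_) r+a ⟨
          suc (toℕ i) + (r + a)                   ≡⟨ rearrange₂ (toℕ i) r a ⟩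
          r + (suc (toℕ i) + a)                   ≤⟨ +-monoʳ-≤ r (m≤n+m∸n _ m) ⟩
          r + (m + ((suc (toℕ i) + a) ∸ m))       ≡⟨ cong (r +_) (+-comm m _) ⟩
          r + ((suc (toℕ i) + a) ∸ m + m)         ≡⟨ +-assoc r _ m ⟨
          r + ((suc (toℕ i) + a) ∸ m) + m         ∎)

        lower : (suc (toℕ i) + a) ∸ m ≤ r + suc (toℕ i + suc m)
        lower = m≤n+o⇒m∸n≤o _ m (begin
          suc (toℕ i) + a                         ≤⟨ +-monoʳ-≤ (suc (toℕ i)) (m≤n+m a r) ⟩
          suc (toℕ i) + (r + a)                   ≡⟨ cong (suc (toℕ i) +_) r+a ⟩
          suc (toℕ i) + suc (2 * m)               ≤⟨ m≤m+n _ r ⟩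
          suc (toℕ i) + suc (2 * m) + r           ≡⟨ rearrange₃ (toℕ i) m r ⟩
          m + (r + suc (toℕ i + suc m))           ∎)

      -- A step up the chain changes `M * (q ⊓ h)` by `M` below the hook and by nothing beyond it.
      detour-within : ∀ k {q q′} → suc q ≡ q′ → Within M (detourLevel k q) (detourLevel k q′)
      detour-within k {q} refl = raisedIf-within (toℕ i ≤? m) (toℕ i ≤? m) (λ p → p) (λ p → p)
        (λ _ → ≤-trans (∸-monoˡ-≤ m (+-monoʳ-≤ c (*-monoʳ-≤ M (⊓-monoˡ-≤ h (n≤1+n q))))) (m≤n+m _ M) ,
               m≤n+o⇒m∸n≤o _ m (begin
                 c + M * (suc q ⊓ h)             ≤⟨ +-monoʳ-≤ c (*-monoʳ-≤ M (⊓-monoʳ-≤ (suc q) (n≤1+n h))) ⟩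
                 c + M * suc (q ⊓ h)             ≡⟨ cong (c +_) (*-suc M (q ⊓ h)) ⟩
                 c + (M + x)                     ≡⟨ exchange c M x ⟩
                 M + (c + x)                     ≤⟨ +-monoʳ-≤ M (m≤n+m∸n (c + x) m) ⟩
                 M + (m + ((c + x) ∸ m))         ≡⟨ exchange M m _ ⟩
                 m + (M + ((c + x) ∸ m))         ∎))
        where
        open ≤-Reasoning
        m = toℕ k
        h = hookHeight k
        c = suc (toℕ i)
        x = M * (q ⊓ h)
        exchange : ∀ a b c → a + (b + c) ≡ b + (a + c)
        exchange = solve-∀

      module _ (dark : b i j ≡ false) where

        -- The unset bit enters here. For k < i the default level is 1, and for k > i truncation
        -- also leaves 1, within reach of every target. Only x_i has level 2, and its neighbours
        -- t_j′ have level 1 because `dark` rules out j′ = j.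
        lit-within : ∀ {k j′} → b k j′ ≡ true → Within 1 (detourLevel k 0) (targetLevel j′)
        lit-within {k} {j′} lit = upper , ≤-trans (targetLevel≤1 j′) (s≤s z≤n)
          where
          base : suc (toℕ i) + M * 0 ≡ suc (toℕ i)
          base = trans (cong (suc (toℕ i) +_) (*-zeroʳ M)) (+-identityʳ _)

          upper : detourLevel k 0 ≤ suc (targetLevel j′)
          upper with toℕ i ≤? toℕ k
          ... | no  _   = s≤s z≤n
          ... | yes i≤k rewrite base with i ≟ k
          ...   | no i≢k = s≤s (≤-trans (≤-reflexive (m≤n⇒m∸n≡0 (≤∧≢⇒< i≤k (i≢k ∘ toℕ-injective)))) z≤n)
          ...   | yes refl = s≤s (≤-reflexive (trans (m+n∸n≡m 1 (toℕ i))
                    (sym (targetLevel-other λ { refl → contradiction (trans (sym lit) dark) λ () }))))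

        level-within : ∀ u v {w} → ¬ Cut i u v → combWeight u v ≡ just w → Within w (level u) (level v)
        level-within (spine x)    (spine y)      uncut eq with edgeIf-elim (adjacent? x y) eq
        ... | inj₁ x<y , refl = spine-within x<y
          (λ i≡x → uncut (inj₂ ( cong inj₁ (toℕ-injective (trans (cong suc i≡x) x<y))
                               , cong inj₁ (toℕ-injective (trans (toℕ-inject₁ i) i≡x)))))
        ... | inj₂ y<x , refl = swap (spine-within y<x
          (λ i≡y → uncut (inj₁ ( cong inj₁ (toℕ-injective (trans (cong suc i≡y) y<x))
                               , cong inj₁ (toℕ-injective (trans (toℕ-inject₁ i) i≡y))))))
        level-within (spine x)    (detour k q)   uncut eq with edgeIf-elim (hooked? x k q) eq
        ... | (refl , refl) , refl = hook-within k
        level-within (detour k q) (spine x)      uncut eq with edgeIf-elim (hooked? x k q) eq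
        ... | (refl , refl) , refl = swap (hook-within k)
        level-within (detour k q) (detour k′ q′) uncut eq with edgeIf-elim (linked? k k′ q q′) eq
        ... | (refl , inj₁ q<q′) , refl = detour-within k q<q′
        ... | (refl , inj₂ q′<q) , refl = swap (detour-within k q′<q)
        level-within (detour k q) (target j′)    uncut eq with edgeIf-elim (lit? k q j′) eq
        ... | (refl , lit) , refl = lit-within lit
        level-within (target j′)  (detour k q)   uncut eq with edgeIf-elim (lit? k q j′) eq
        ... | (refl , lit) , refl = swap (lit-within lit)

        level-lipschitz : ∀ u v {w} → weight damaged u v ≡ just w →
                          level (name u) ≤ w + level (name v)
        level-lipschitz u v eq with deletion-reflects {G = comb} {e = cut i} {u} {v} eq
        ... | ¬same , eq′ = proj₁ (level-within (name u) (name v) (¬same ∘ Sum.map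
                (λ (p , q) → endpoint p , endpoint q) (λ (p , q) → endpoint p , endpoint q)) eq′)
          where
          endpoint : ∀ {x y} → x ≡ name y → at x ≡ y
          endpoint p = trans (cong at p) (at-name _)

        level-source : level (name source) ≡ suc (L + suc (toℕ i))
        level-source rewrite name-at (spine (fromℕ L)) | toℕ-fromℕ L with suc (toℕ i) ≤? L
        ... | yes _   = cong suc (trans (cong suc (+-comm (toℕ i) L)) (sym (+-suc L (toℕ i))))
        ... | no  i≮L = contradiction (toℕ<n i) i≮L

        -- The potential falls from L + i + 2 at s to 0 at t_j, one more than the weight of
        -- `lit-walk`.
        dark-far : (p : Walk damaged source (at (target j))) → L + suc (toℕ i) < totalWeight p
        dark-far p = begin
          suc (L + suc (toℕ i))                                  ≡⟨ level-source ⟨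
          level (name source)                                    ≤⟨ potential-bound (level ∘ name) level-lipschitz p ⟩
          totalWeight p + level (name (at (target j)))           ≡⟨ cong (λ v → totalWeight p + level v) (name-at (target j)) ⟩
          totalWeight p + targetLevel j                          ≡⟨ cong (totalWeight p +_) targetLevel-self ⟩
          totalWeight p + 0                                      ≡⟨ +-identityʳ _ ⟩
          totalWeight p                                          ∎
          where open ≤-Reasoning

  -- Recovering the bits from the oracle.

  module _ (D : SingleSourceDSO M) where

    stored : (Fin L → Fin n → Bool) → List Bool
    stored b = preprocess D (Rows.comb b) source

    -- All combs share `order` and `source`, so equal stored strings give equal answers to the query
    -- (t_j, v_{i+1} v_i). One answer cannot serve both combs, since the threshold L + i + 1
    -- separates their distances.
    stored-separates : ∀ {b b′} i j → b i j ≡ true → b′ i j ≡ false → stored b ≢ stored b′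
    stored-separates {b} {b′} i j lit dark same =
      distances-differ _ (lit-walk b i j lit) (dark-far b′ i j dark)
        (answer b) (subst (λ x → IsDistance (damaged b′ i) source (at (target j))
                              (query D source x (at (target j)) (cut i)))
                            (sym same) (answer b′))
      where
      answer : ∀ b → IsDistance (damaged b i) source (at (target j))
                                (query D source (stored b) (at (target j)) (cut i))
      answer b = correct D (Rows.comb b) source (at (target j)) (cut i) (cut-isEdge b i)

    stored-injective : ∀ {b b′} → stored b ≡ stored b′ → ∀ i j → b i j ≡ b′ i j
    stored-injective {b} {b′} same i j with b i j in eq | b′ i j in eq′
    ... | false | false = refl
    ... | true  | true  = refl
    ... | true  | false = contradiction same (stored-separates i j eq eq′)
    ... | false | true  = contradiction (sym same) (stored-separates i j eq′ eq)

    rows : Fin (2 ^ (L * n)) → Fin L → Fin n → Bool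
    rows c i j = bit {L * n} c (combine i j)

    -- A comb is coded by L n bits and `stored` is injective on these codes, so counting strings
    -- applies.
    large-space : ∃[ c ] L * n ≤ space D (Rows.comb (rows c)) source
    large-space = injection-has-long-string (L * n) (stored ∘ rows) λ {c} {c′} same →
      bit-injective {L * n} λ q → let i , j , ij≡q = combine-surjective {L} {n} q in
        subst (λ q → bit {L * n} c q ≡ bit c′ q) ij≡q (stored-injective same i j)

-- Choice of the spine length and the final arithmetic.

integerSqrt : ∀ m → ∃[ r ] r * r ≤ m × m < suc r * suc r
integerSqrt zero    = 0 , z≤n , s≤s z≤n
integerSqrt (suc m) with integerSqrt m
... | r , r²≤m , m<[1+r]² with suc m <? suc r * suc r
...   | yes 1+m<[1+r]² = r , m≤n⇒m≤1+n r²≤m , 1+m<[1+r]²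
...   | no  1+m≮[1+r]² = suc r , ≮⇒≥ 1+m≮[1+r]² ,
        ≤-<-trans m<[1+r]² (*-mono-< {suc r} (n<1+n _) (n<1+n _))

-- Positivity of `m` forces r to be at least 1, whence r + 1 is at most 2r: rounding the root down
-- costs at most a factor 2.
integerSqrt-upper : ∀ {m} r → 1 ≤ m → m < suc r * suc r → m ≤ (2 * r) * (2 * r)
integerSqrt-upper zero    1≤m m<1 = contradiction m<1 (≤⇒≯ 1≤m)
integerSqrt-upper (suc r) 1≤m m<  = ≤-trans (<⇒≤ m<) (*-mono-≤ 2+r≤ 2+r≤)
  where
  2+r≤ : suc (suc r) ≤ 2 * suc r
  2+r≤ = s≤s (≤-trans (s≤s (m≤m+n r 0)) (m≤n+m _ r))

square-cancel-≤ : ∀ {m n} → m * m ≤ n * n → m ≤ n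
square-cancel-≤ m²≤n² = ≮⇒≥ λ n<m → <⇒≱ (*-mono-< n<m n<m) m²≤n²

-- The chains have L + L ⌊2L/M⌋ vertices in all, and the second term is at most 2L²/M, hence at most
-- 2n. The spine adds at most 2n and the targets n.
order-linear : ∀ M L n .{{_ : NonZero M}} → 1 ≤ n → L ≤ n → L * L ≤ M * n → Comb.order M L n ≤ 6 * n
order-linear M L n 1≤n L≤n L²≤Mn = begin
  suc L + (L * suc (2 * L / M) + n)     ≡⟨ cong (λ x → suc L + (x + n)) (*-suc L (2 * L / M)) ⟩
  suc L + ((L + L * (2 * L / M)) + n)   ≤⟨ +-mono-≤ (+-mono-≤ 1≤n L≤n) (+-monoˡ-≤ n (+-mono-≤ L≤n chains)) ⟩
  (n + n) + ((n + 2 * n) + n)           ≡⟨ collect n ⟩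
  6 * n                                 ∎
  where
  open ≤-Reasoning
  collect : ∀ n → (n + n) + ((n + 2 * n) + n) ≡ 6 * n
  collect = solve-∀
  rearrange₁ : ∀ L x M → M * (L * x) ≡ L * (x * M)
  rearrange₁ = solve-∀
  rearrange₂ : ∀ L → L * (2 * L) ≡ 2 * (L * L)
  rearrange₂ = solve-∀
  rearrange₃ : ∀ M n → 2 * (M * n) ≡ M * (2 * n)
  rearrange₃ = solve-∀

  chains : L * (2 * L / M) ≤ 2 * n
  chains = *-cancelˡ-≤ M (begin
    M * (L * (2 * L / M))     ≡⟨ rearrange₁ L (2 * L / M) M ⟩
    L * ((2 * L / M) * M)     ≤⟨ *-monoʳ-≤ L (m/n*n≤m (2 * L) M) ⟩
    L * (2 * L)               ≡⟨ rearrange₂ L ⟩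
    2 * (L * L)               ≤⟨ *-monoʳ-≤ 2 L²≤Mn ⟩
    2 * (M * n)               ≡⟨ rearrange₃ M n ⟩
    M * (2 * n)               ∎)

-- Taking the factor n² out of the minimum leaves min(M n, n²), the quantity whose root is L up to
-- the factor 2; and 4L²n² is the square of 2Ln.
space-bound : ∀ M L n x → (M * n) ⊓ (n * n) ≤ (2 * L) * (2 * L) → L * n ≤ x →
              min[√M·n^3/2,n²]≤ M n (2 * x)
space-bound M L n x m≤4L² Ln≤x = begin
  (M * n ^ 3) ⊓ (n ^ 4)                   ≡⟨ cong₂ _⊓_ (rearrange₁ M n) (rearrange₂ n) ⟩
  (M * n * (n * n)) ⊓ (n * n * (n * n))   ≡⟨ *-distribʳ-⊓ (n * n) (M * n) (n * n) ⟨
  ((M * n) ⊓ (n * n)) * (n * n)           ≤⟨ *-monoˡ-≤ (n * n) m≤4L² ⟩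
  ((2 * L) * (2 * L)) * (n * n)           ≡⟨ rearrange₃ L n ⟩
  (2 * (L * n)) ^ 2                       ≤⟨ ^-monoˡ-≤ 2 (*-monoʳ-≤ 2 Ln≤x) ⟩
  (2 * x) ^ 2                             ∎
  where
  open ≤-Reasoning
  rearrange₁ : ∀ M n → M * (n * (n * (n * 1))) ≡ M * n * (n * n)
  rearrange₁ = solve-∀
  rearrange₂ : ∀ n → n * (n * (n * (n * 1))) ≡ n * n * (n * n)
  rearrange₂ = solve-∀
  rearrange₃ : ∀ L n → ((2 * L) * (2 * L)) * (n * n) ≡ (2 * (L * n)) * ((2 * (L * n)) * 1)
  rearrange₃ = solve-∀

theorem4 : ∃[ K ] ∃[ C ] ∀ (M n : ℕ) → 1 ≤ M → 1 ≤ n → (D : SingleSourceDSO M) →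
    ∃[ N ] N ≤ K * n × (Σ[ G ∈ Graph N M ] Σ[ s ∈ Fin N ]
    min[√M·n^3/2,n²]≤ M n (C * space D G s))
-- The 6 is the constant of `order-linear`, and the 2 is the rounding loss of `integerSqrt-upper`.
theorem4 = 6 , 2 , bound
  where
  bound : ∀ (M n : ℕ) → 1 ≤ M → 1 ≤ n → (D : SingleSourceDSO M) →
    ∃[ N ] N ≤ 6 * n × (Σ[ G ∈ Graph N M ] Σ[ s ∈ Fin N ]
    min[√M·n^3/2,n²]≤ M n (2 * space D G s))
  bound M n 1≤M 1≤n D with integerSqrt ((M * n) ⊓ (n * n))
  ... | L , L²≤m , m<[1+L]² =
    order , order-linear M L n 1≤n L≤n L²≤Mn , Rows.comb (rows D c) , source ,
    space-bound M L n _ (integerSqrt-upper L 1≤m m<[1+L]²) Ln≤space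
    where
    instance
      M≢0 : NonZero M
      M≢0 = >-nonZero 1≤M
    open Comb M L n

    L²≤Mn : L * L ≤ M * n
    L²≤Mn = ≤-trans L²≤m (m⊓n≤m _ _)

    L≤n : L ≤ n
    L≤n = square-cancel-≤ (≤-trans L²≤m (m⊓n≤n (M * n) _))

    1≤m : 1 ≤ (M * n) ⊓ (n * n)
    1≤m = ⊓-glb (*-mono-≤ 1≤M 1≤n) (*-mono-≤ 1≤n 1≤n)

    c = proj₁ (large-space D)
    Ln≤space = proj₂ (large-space D)
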